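{- Let $\sigma\in\{st,co,gr,pr,se,id,ea,na,stg\}$, let $v\subseteq \mathtt{Prp}$ be a valuation and let $(A,R)$ be an argumentation framework (over $\mathcal U$). Then: (1) $v\models \varphi_\sigma$ if and only if $\mathsf{E}_v\in\sigma(A_v,R_v)$; (2) $\sigma(A,R)=\{\mathsf{E}_v \mid (v_{(A,R)},v)\in ||\mathsf{makeExt}^{\sigma}||\}$.
   Context: **Argumentation.** Fix a finite non-empty set $\mathcal U$ of arguments. For $A\subseteq\mathcal U$, $R\subseteq\mathcal U\times\mathcal U$, let $R\upharpoonright_A=R\cap(A\times A)$. An argumentation framework (AF) is a pair $(A,R)$ with $A\subseteq\mathcal U$, $R\subseteq A\times A$. For $E\subseteq A$: $E^+=\{x\in A\mid\exists y\in E:(y,x)\in R\}$, $E^\oplus=E\cup E^+$ (range). $E$ is conflict-free iff $E\cap E^+=\emptyset$; $E$ defends $a\in A$ iff every $x\in A$ with $(x,a)\in R$ is in $E^+$; $E$ is admissible iff it is conflict-free and defends all its members. $\sigma(A,R)$ denotes the set of $\sigma$-extensions of $(A,R)$, where $E\subseteq A$ is: stable ($st$) iff conflict-free and $A\setminus E\subseteq E^+$; complete ($co$) iff conflict-free and $E$ contains precisely the arguments of $A$ it defends; grounded ($gr$) iff a $\subseteq$-minimal complete extension; preferred ($pr$) iff a $\subseteq$-maximal complete extension; semi-stable ($se$) iff complete and there is no complete $E'$ with $E^\oplus\subset E'^\oplus$ (strict); ideal ($id$) iff the $\subseteq$-maximal ideal set, an ideal set being an admissible set contained in every preferred extension; eager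 ($ea$) iff the $\subseteq$-maximal eager set, an eager set being an admissible set contained in every semi-stable extension; naive ($na$) iff a $\subseteq$-maximal conflict-free set; stage ($stg$) iff conflict-free with $\subseteq$-maximal range among conflict-free sets. **DL-PA.** $\mathtt{Prp}$ is a countably infinite set of propositional variables containing the pairwise distinct variables $\mathtt{aw}_x$, $\mathtt{in}_x$ ($x\in\mathcal U$), $\mathtt r_{x,y}$ ($x,y\in\mathcal U$), and further fresh variables $\mathtt{in}'_x$ ($x\in\mathcal U$). Let $\mathsf{IN}_{\mathcal U}=\{\mathtt{in}_x\mid x\in\mathcal U\}$. Formulas and programs: $\varphi::=p\mid\neg\varphi\mid(\varphi\wedge\varphi)\mid[\pi]\varphi$ and $\pi::=+p\mid -p\mid\varphi?\mid(\pi;\pi)\mid(\pi\cup\pi)\mid\pi^{ -1}$, $p\in\mathtt{Prp}$. Valuations are subsets $v\subseteq\mathtt{Prp}$; $v\models p$ iff $p\in v$; Booleans as usual; $v\models[\pi]\varphi$ iff $v'\models\varphi$ for all $v'$ with $(v,v')\in||\pi||$; $\langle\pi\rangle\varphi=\neg[\pi]\neg\varphi$. Programs are interpreted by $||+p||=\{(v,v\cup\{p\})\}$, $||-p||=\{(v,v\setminus\{p\})\}$, $||\varphi?||=\{(v,v)\mid v\models\varphi\}$, $;$ is relation composition, $\cup$ is union, $\pi^{ -1}$ is the inverse relation. $\mathsf{skip}=\top?$. For finite $P=\{p_1,\dots,p_n\}\subseteq\mathtt{Prp}$: $\mathsf{mkTrueOne}(P)=\bigcup_{p\in P}(\neg p?;+p)$,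 $\mathsf{mkFalseOne}(P)=\bigcup_{p\in P}(p?;-p)$, $\mathsf{mkTrueSome}(P)=(+p_1\cup\mathsf{skip});\dots;(+p_n\cup\mathsf{skip})$, $\mathsf{mkFalseSome}(P)=(-p_1\cup\mathsf{skip});\dots;(-p_n\cup\mathsf{skip})$, $\mathsf{vary}(P)=(+p_1\cup -p_1);\dots;(+p_n\cup -p_n)$ (empty sequences and unions are $\mathsf{skip}$). **Valuations and AFs.** $A_v=\{x\in\mathcal U\mid\mathtt{aw}_x\in v\}$, $R_v=\{(x,y)\in A_v\times A_v\mid\mathtt r_{x,y}\in v\}$, $\mathsf E_v=\{x\in\mathcal U\mid\mathtt{in}_x\in v\}$, and $v_{(A,R)}=\{\mathtt{aw}_x\mid x\in A\}\cup\{\mathtt r_{x,y}\mid(x,y)\in R\}$. **Encodings.** For each $\sigma$, $\mathsf{makeExt}^\sigma=\mathsf{vary}(\mathsf{IN}_{\mathcal U});\varphi_\sigma?$, where $\varphi_{st}=\mathsf{Stable}$, $\varphi_{co}=\mathsf{Complete}$, $\varphi_{gr}=\mathsf{Grounded}$, $\varphi_{pr}=\mathsf{Preferred}$, $\varphi_{na}=\mathsf{Naive}$, $\varphi_{se}=\mathsf{SemiStable}$, $\varphi_{stg}=\mathsf{Stage}$, $\varphi_{id}=\mathsf{Ideal}$, $\varphi_{ea}=\mathsf{Eager}$ are the following (all indices range over $\mathcal U$): $\mathsf{Well}=\bigwedge_x(\mathtt{in}_x\to\mathtt{aw}_x)$; $\mathsf{ConFree}=\mathsf{Well}\wedge\bigwedge_x\bigwedge_y\neg(\mathtt{in}_x\wedge\mathtt{in}_y\wedge\mathtt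 r_{x,y})$; $\mathsf{Admissible}=\mathsf{ConFree}\wedge\bigwedge_x(\mathtt{in}_x\to\bigwedge_y((\mathtt{aw}_y\wedge\mathtt r_{y,x})\to\bigvee_z(\mathtt{in}_z\wedge\mathtt r_{z,y})))$; $\mathsf{copy}(\mathsf{IN}_{\mathcal U})$ = sequential composition over $x\in\mathcal U$ of $(\mathtt{in}_x?;+\mathtt{in}'_x)\cup(\neg\mathtt{in}_x?;-\mathtt{in}'_x)$; $\mathsf{Rg}_x=\mathtt{in}_x\vee(\mathtt{aw}_x\wedge\bigvee_y(\mathtt{in}_y\wedge\mathtt r_{y,x}))$, $\mathsf{Rg}'_x=\mathtt{in}'_x\vee(\mathtt{aw}_x\wedge\bigvee_y(\mathtt{in}'_y\wedge\mathtt r_{y,x}))$, $\mathsf{IncludedInCp}=\bigwedge_x(\mathsf{Rg}_x\to\mathsf{Rg}'_x)$, $\mathsf{IncludesCp}=\bigwedge_x(\mathsf{Rg}'_x\to\mathsf{Rg}_x)$; $\mathsf{Stable}=\mathsf{Well}\wedge\bigwedge_x(\mathtt{aw}_x\to(\mathtt{in}_x\leftrightarrow\neg\bigvee_y(\mathtt{in}_y\wedge\mathtt r_{y,x})))$; $\mathsf{Complete}=\mathsf{ConFree}\wedge\bigwedge_x(\mathtt{in}_x\leftrightarrow\bigwedge_y((\mathtt{aw}_y\wedge\mathtt r_{y,x})\to\bigvee_z(\mathtt{in}_z\wedge\mathtt r_{z,y})))$; $\mathsf{Grounded}=\mathsf{Complete}\wedge[\mathsf{mkFalseOne}(\mathsf{IN}_{\mathcal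 U});\mathsf{mkFalseSome}(\mathsf{IN}_{\mathcal U})]\neg\mathsf{Complete}$; $\mathsf{Preferred}=\mathsf{Admissible}\wedge[\mathsf{mkTrueOne}(\mathsf{IN}_{\mathcal U});\mathsf{mkTrueSome}(\mathsf{IN}_{\mathcal U})]\neg\mathsf{Admissible}$; $\mathsf{Naive}=\mathsf{ConFree}\wedge[\mathsf{mkTrueOne}(\mathsf{IN}_{\mathcal U})]\neg\mathsf{ConFree}$; $\mathsf{SemiStable}=\mathsf{Complete}\wedge[\mathsf{copy}(\mathsf{IN}_{\mathcal U});\mathsf{makeExt}^{co}](\mathsf{IncludesCp}\to\mathsf{IncludedInCp})$; $\mathsf{Stage}=\mathsf{ConFree}\wedge[\mathsf{copy}(\mathsf{IN}_{\mathcal U});\mathsf{vary}(\mathsf{IN}_{\mathcal U});\mathsf{ConFree}?](\mathsf{IncludesCp}\to\mathsf{IncludedInCp})$; $\mathsf{IdealSet}=\mathsf{Admissible}\wedge\bigwedge_x(\mathtt{in}_x\to[\mathsf{makeExt}^{pr}]\mathtt{in}_x)$, $\mathsf{EagerSet}=\mathsf{Admissible}\wedge\bigwedge_x(\mathtt{in}_x\to[\mathsf{makeExt}^{se}]\mathtt{in}_x)$; $\mathsf{Ideal}=\mathsf{IdealSet}\wedge[\mathsf{mkTrueOne}(\mathsf{IN}_{\mathcal U});\mathsf{mkTrueSome}(\mathsf{IN}_{\mathcal U})]\neg\mathsf{IdealSet}$; $\mathsf{Eager}=\mathsf{EagerSet}\wedge[\mathsf{mkTrueOne}(\mathsf{IN}_{\mathcal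 U});\mathsf{mkTrueSome}(\mathsf{IN}_{\mathcal U})]\neg\mathsf{EagerSet}$.
   Formalization: In Complete, the biconditional for each x is required only when aw_x holds (aw_x → (in_x ↔ ...)); as stated, without this guard, the claim fails for co, gr, se, ea, e.g. for the framework (∅,∅) with v=∅. -}

module Defs where

open import Data.Bool using (Bool; true; false; T; if_then_else_; _∨_)
open import Data.Fin using (Fin)
open import Data.Fin.Properties using (any?)
open import Data.Fin.Subset using (Subset; _∈_; _∉_; _⊆_; _⊂_; _⊃_)
open import Data.Fin.Subset.Properties using (_∈?_)
open import Data.List using (List; []; _∷_; map; allFin)
open import Data.Nat using (ℕ)
import Data.Nat.Properties as ℕ
open import Data.Product using (_×_; proj₁; ∃-syntax)
open import Data.Sum using (_⊎_)
open import Data.Vec using (tabulate)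
open import Function using (_⇔_; _↔_; Injective)
open import Function.Properties.Inverse using (↔⇒↣)
open import Function.Bundles using (Inverse)
open import Level using (0ℓ)
open import Relation.Binary using (Rel; DecidableEquality)
open import Relation.Binary.PropositionalEquality using (_≡_; _≗_)
open import Relation.Nullary using (¬_; Dec; ⌊_⌋; _×-dec_)
open import Relation.Nullary.Decidable using (via-injection; toWitness; T?)
open import Relation.Unary using (Pred)
import Relation.Unary as Unary

------------------------------------------------------------------------
-- Argumentation.  The set 𝒰 of arguments is Fin n.

record AF (n : ℕ) : Set where
  field
    A     : Subset n
    R     : Fin n → Fin n → Bool
    R⊆A×A : ∀ {x y} → T (R x y) → x ∈ A × y ∈ A

Maximal : ∀ {X : Set} → Rel X 0ℓ → Pred X 0ℓ → Pred X 0ℓ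
Maximal _<_ P x = P x × (∀ y → P y → ¬ (x < y))

data Semantics : Set where
  st co gr pr se id ea na stg : Semantics

module _ {n : ℕ} (F : AF n) where
  open AF F

  infix 8 _⁺ _⊕

  _⁺ : Subset n → Pred (Fin n) 0ℓ
  (E ⁺) x = x ∈ A × ∃[ y ] (y ∈ E × T (R y x))

  _⊕ : Subset n → Pred (Fin n) 0ℓ
  E ⊕ = (_∈ E) Unary.∪ (E ⁺)

  _⊂⊕_ : Rel (Subset n) 0ℓ
  E ⊂⊕ E′ = (E ⊕) Unary.⊂ (E′ ⊕)

  Defends : Subset n → Pred (Fin n) 0ℓ
  Defends E a = ∀ x → x ∈ A → T (R x a) → (E ⁺) x

  ConflictFree : Pred (Subset n) 0ℓ
  ConflictFree E = E ⊆ A × (∀ x → ¬ (x ∈ E × (E ⁺) x))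

  IsAdmissible : Pred (Subset n) 0ℓ
  IsAdmissible E = ConflictFree E × (∀ a → a ∈ E → Defends E a)

  IsStable : Pred (Subset n) 0ℓ
  IsStable E = ConflictFree E × (∀ x → x ∈ A → x ∉ E → (E ⁺) x)

  IsComplete : Pred (Subset n) 0ℓ
  IsComplete E = ConflictFree E × (∀ a → a ∈ A → (a ∈ E ⇔ Defends E a))

  IsGrounded : Pred (Subset n) 0ℓ
  IsGrounded = Maximal _⊃_ IsComplete

  IsPreferred : Pred (Subset n) 0ℓ
  IsPreferred = Maximal _⊂_ IsComplete

  IsSemiStable : Pred (Subset n) 0ℓ
  IsSemiStable = Maximal _⊂⊕_ IsComplete

  IsIdealSet : Pred (Subset n) 0ℓ
  IsIdealSet E = IsAdmissible E × (∀ P → IsPreferred P → E ⊆ P)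

  IsIdeal : Pred (Subset n) 0ℓ
  IsIdeal = Maximal _⊂_ IsIdealSet

  IsEagerSet : Pred (Subset n) 0ℓ
  IsEagerSet E = IsAdmissible E × (∀ S → IsSemiStable S → E ⊆ S)

  IsEager : Pred (Subset n) 0ℓ
  IsEager = Maximal _⊂_ IsEagerSet

  IsNaive : Pred (Subset n) 0ℓ
  IsNaive = Maximal _⊂_ ConflictFree

  IsStage : Pred (Subset n) 0ℓ
  IsStage = Maximal _⊂⊕_ ConflictFree

Extensions : ∀ {n} → Semantics → AF n → Pred (Subset n) 0ℓ
Extensions st  = IsStable
Extensions co  = IsComplete
Extensions gr  = IsGrounded
Extensions pr  = IsPreferred
Extensions se  = IsSemiStable
Extensions id  = IsIdeal
Extensions ea  = IsEager
Extensions na  = IsNaive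
Extensions stg = IsStage

------------------------------------------------------------------------
-- Propositional variables

data Var (n : ℕ) : Set where
  aw in° in′ : Fin n → Var n
  r          : Fin n → Fin n → Var n

record Vocabulary (n : ℕ) : Set₁ where
  field
    Prp           : Set
    countable     : Prp ↔ ℕ
    var           : Var n → Prp
    var-injective : Injective _≡_ _≡_ var

  infix 4 _≟_

  _≟_ : DecidableEquality Prp
  _≟_ = via-injection (↔⇒↣ countable) ℕ._≟_

-- Unlike foldr, no unit is appended to a non-empty list: a trailing skip
-- would change the meaning of an iterated union of programs.
fold₁ : ∀ {X : Set} → (X → X → X) → X → List X → X
fold₁ _∙_ ε []           = ε
fold₁ _∙_ ε (x ∷ [])     = x
fold₁ _∙_ ε (x ∷ y ∷ xs) = x ∙ fold₁ _∙_ ε (y ∷ xs)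

module DL-PA {n : ℕ} (L : Vocabulary n) where
  open Vocabulary L

  infix  30 ¬ᶠ_ +ᵖ_ -ᵖ_ [_]_
  infix  29 _⁇
  infixr 25 _∧ᶠ_
  infixr 24 _∨ᶠ_
  infixr 23 _⇒ᶠ_
  infix  22 _⇔ᶠ_
  infixr 20 _⨾_
  infixr 19 _∪ᵖ_

  mutual
    data Formula : Set where
      atom : Prp → Formula
      ¬ᶠ_  : Formula → Formula
      _∧ᶠ_ : Formula → Formula → Formula
      [_]_ : Program → Formula → Formula

    data Program : Set where
      +ᵖ_ -ᵖ_ : Prp → Program
      _⁇      : Formula → Program
      _⨾_     : Program → Program → Program
      _∪ᵖ_    : Program → Program → Program
      _⁻¹     : Program → Program

  Valuation : Set
  Valuation = Prp → Bool

  _[_↦_] : Valuation → Prp → Bool → Valuation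
  (v [ p ↦ b ]) q = if ⌊ q ≟ p ⌋ then b else v q

  infix 4 _⊨_

  -- Sets of variables are compared extensionally, hence _≗_.
  mutual
    _⊨_ : Valuation → Formula → Set
    v ⊨ atom p    = T (v p)
    v ⊨ ¬ᶠ φ      = ¬ (v ⊨ φ)
    v ⊨ (φ ∧ᶠ ψ)  = v ⊨ φ × v ⊨ ψ
    v ⊨ ([ π ] φ) = ∀ v′ → ∥ π ∥ v v′ → v′ ⊨ φ

    ∥_∥ : Program → Rel Valuation 0ℓ
    ∥ +ᵖ p ∥    v v′ = v′ ≗ v [ p ↦ true ]
    ∥ -ᵖ p ∥    v v′ = v′ ≗ v [ p ↦ false ]
    ∥ φ ⁇ ∥     v v′ = v ≗ v′ × v ⊨ φ
    ∥ π ⨾ ρ ∥   v v′ = ∃[ w ] (∥ π ∥ v w × ∥ ρ ∥ w v′)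
    ∥ π ∪ᵖ ρ ∥  v v′ = ∥ π ∥ v v′ ⊎ ∥ ρ ∥ v v′
    ∥ π ⁻¹ ∥    v v′ = ∥ π ∥ v′ v

  ⊥ᶠ ⊤ᶠ : Formula
  ⊥ᶠ = atom p₀ ∧ᶠ ¬ᶠ atom p₀ where p₀ = Inverse.from countable 0
  ⊤ᶠ = ¬ᶠ ⊥ᶠ

  _∨ᶠ_ _⇒ᶠ_ _⇔ᶠ_ : Formula → Formula → Formula
  φ ∨ᶠ ψ = ¬ᶠ (¬ᶠ φ ∧ᶠ ¬ᶠ ψ)
  φ ⇒ᶠ ψ = ¬ᶠ (φ ∧ᶠ ¬ᶠ ψ)
  φ ⇔ᶠ ψ = (φ ⇒ᶠ ψ) ∧ᶠ (ψ ⇒ᶠ φ)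

  ⋀ ⋁ : (Fin n → Formula) → Formula
  ⋀ f = fold₁ _∧ᶠ_ ⊤ᶠ (map f (allFin n))
  ⋁ f = fold₁ _∨ᶠ_ ⊥ᶠ (map f (allFin n))

  skip : Program
  skip = ⊤ᶠ ⁇

  Seq Choice : List Program → Program
  Seq    = fold₁ _⨾_ skip
  Choice = fold₁ _∪ᵖ_ skip

  mkTrueOne mkFalseOne mkTrueSome mkFalseSome vary : List Prp → Program
  mkTrueOne   P = Choice (map (λ p → (¬ᶠ atom p) ⁇ ⨾ +ᵖ p) P)
  mkFalseOne  P = Choice (map (λ p → atom p ⁇ ⨾ -ᵖ p) P)
  mkTrueSome  P = Seq (map (λ p → +ᵖ p ∪ᵖ skip) P)
  mkFalseSome P = Seq (map (λ p → -ᵖ p ∪ᵖ skip) P)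
  vary        P = Seq (map (λ p → +ᵖ p ∪ᵖ -ᵖ p) P)

  ----------------------------------------------------------------------
  -- Valuations and AFs

  subsetOf : (Fin n → Var n) → Valuation → Subset n
  subsetOf f v = tabulate (λ x → v (var (f x)))

  𝖠 𝖤 : Valuation → Subset n
  𝖠 = subsetOf aw
  𝖤 = subsetOf in°

  R? : (v : Valuation) (x y : Fin n) →
       Dec ((x ∈ 𝖠 v × y ∈ 𝖠 v) × T (v (var (r x y))))
  R? v x y = ((x ∈? 𝖠 v) ×-dec (y ∈? 𝖠 v)) ×-dec T? (v (var (r x y)))

  frame : Valuation → AF n
  frame v = record
    { A     = 𝖠 v
    ; R     = λ x y → ⌊ R? v x y ⌋
    ; R⊆A×A = λ {x} {y} xy∈R → proj₁ (toWitness {a? = R? v x y} xy∈R)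
    }

  valuation : AF n → Valuation
  valuation F p =
    ⌊ any? (λ x → (p ≟ var (aw x)) ×-dec (x ∈? A)) ⌋ ∨
    ⌊ any? (λ x → any? λ y → (p ≟ var (r x y)) ×-dec T? (R x y)) ⌋
    where open AF F

  ----------------------------------------------------------------------
  -- Encodings

  𝚊𝚠 𝚒𝚗 𝚒𝚗′ : Fin n → Formula
  𝚊𝚠  x = atom (var (aw x))
  𝚒𝚗  x = atom (var (in° x))
  𝚒𝚗′ x = atom (var (in′ x))

  𝚛 : Fin n → Fin n → Formula
  𝚛 x y = atom (var (r x y))

  IN : List Prp
  IN = map (λ x → var (in° x)) (allFin n)

  vary-such-that : Formula → Program
  vary-such-that φ = vary IN ⨾ φ ⁇

  Well ConFree Admissible Stable Complete : Formula

  Well = ⋀ λ x → 𝚒𝚗 x ⇒ᶠ 𝚊𝚠 x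

  ConFree = Well ∧ᶠ ⋀ λ x → ⋀ λ y → ¬ᶠ (𝚒𝚗 x ∧ᶠ 𝚒𝚗 y ∧ᶠ 𝚛 x y)

  Defended : Fin n → Formula
  Defended x = ⋀ λ y → (𝚊𝚠 y ∧ᶠ 𝚛 y x) ⇒ᶠ ⋁ λ z → 𝚒𝚗 z ∧ᶠ 𝚛 z y

  Admissible = ConFree ∧ᶠ ⋀ λ x → 𝚒𝚗 x ⇒ᶠ Defended x

  Stable = Well ∧ᶠ ⋀ λ x → 𝚊𝚠 x ⇒ᶠ (𝚒𝚗 x ⇔ᶠ ¬ᶠ ⋁ λ y → 𝚒𝚗 y ∧ᶠ 𝚛 y x)

  -- The guard 𝚊𝚠 x is absent from the published formula but indispensable:
  -- without it an x outside 𝖠 v that has no attackers would have to be in,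
  -- contradicting Well, so that for instance (∅ , ∅) would be encoded as
  -- having no complete extension.
  Complete = ConFree ∧ᶠ ⋀ λ x → 𝚊𝚠 x ⇒ᶠ (𝚒𝚗 x ⇔ᶠ Defended x)

  copyOne : Fin n → Program
  copyOne x = 𝚒𝚗 x ⁇ ⨾ +ᵖ var (in′ x) ∪ᵖ (¬ᶠ 𝚒𝚗 x) ⁇ ⨾ -ᵖ var (in′ x)

  copy : Program
  copy = Seq (map copyOne (allFin n))

  Rg Rg′ : Fin n → Formula
  Rg  x = 𝚒𝚗  x ∨ᶠ (𝚊𝚠 x ∧ᶠ ⋁ λ y → 𝚒𝚗  y ∧ᶠ 𝚛 y x)
  Rg′ x = 𝚒𝚗′ x ∨ᶠ (𝚊𝚠 x ∧ᶠ ⋁ λ y → 𝚒𝚗′ y ∧ᶠ 𝚛 y x)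

  IncludedInCp IncludesCp : Formula
  IncludedInCp = ⋀ λ x → Rg x ⇒ᶠ Rg′ x
  IncludesCp   = ⋀ λ x → Rg′ x ⇒ᶠ Rg x

  Grounded Preferred Naive SemiStable Stage : Formula

  Grounded = Complete ∧ᶠ [ mkFalseOne IN ⨾ mkFalseSome IN ] ¬ᶠ Complete

  Preferred = Admissible ∧ᶠ [ mkTrueOne IN ⨾ mkTrueSome IN ] ¬ᶠ Admissible

  Naive = ConFree ∧ᶠ [ mkTrueOne IN ] ¬ᶠ ConFree

  SemiStable =
    Complete ∧ᶠ [ copy ⨾ vary-such-that Complete ] (IncludesCp ⇒ᶠ IncludedInCp)

  Stage =
    ConFree ∧ᶠ [ copy ⨾ vary-such-that ConFree ] (IncludesCp ⇒ᶠ IncludedInCp)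

  IdealSet EagerSet Ideal Eager : Formula

  IdealSet =
    Admissible ∧ᶠ ⋀ λ x → 𝚒𝚗 x ⇒ᶠ [ vary-such-that Preferred ] 𝚒𝚗 x

  EagerSet =
    Admissible ∧ᶠ ⋀ λ x → 𝚒𝚗 x ⇒ᶠ [ vary-such-that SemiStable ] 𝚒𝚗 x

  Ideal = IdealSet ∧ᶠ [ mkTrueOne IN ⨾ mkTrueSome IN ] ¬ᶠ IdealSet

  Eager = EagerSet ∧ᶠ [ mkTrueOne IN ⨾ mkTrueSome IN ] ¬ᶠ EagerSet

  encoding : Semantics → Formula
  encoding st  = Stable
  encoding co  = Complete
  encoding gr  = Grounded
  encoding pr  = Preferred
  encoding se  = SemiStable
  encoding id  = Ideal
  encoding ea  = Eager
  encoding na  = Naive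
  encoding stg = Stage

  makeExt : Semantics → Program
  makeExt σ = vary-such-that (encoding σ)

{-# OPTIONS --safe #-}
-- Every formula is ¬¬-stable, so its classical connectives may be read
-- constructively.  Up to extensional equality, the programs vary,
-- mkTrueOne ⨾ mkTrueSome, mkFalseOne ⨾ mkFalseSome and copy change only the
-- variables in or in′: arbitrarily, by strictly enlarging or shrinking 𝖤, or by
-- setting in′ to in.  Hence [_] quantifies over the subsets E competing with
-- 𝖤 v for maximality, while the represented framework stays fixed.  The one
-- argumentation-theoretic ingredient is that maximal admissible sets are
-- exactly the maximal complete ones: by the fundamental lemma a defended
-- argument can be added to an admissible set, so admissible sets grow into
-- complete ones.

module Submission where

open import Defs
open import Data.Nat using (ℕ; NonZero)
open import Data.Product using (_×_; ∃-syntax)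
open import Function using (_⇔_)
open import Relation.Binary.PropositionalEquality using (_≡_)
open import Relation.Unary using (_∈_; _≐_)

open import Data.Bool using (Bool; true; false; not; T)
import Data.Bool.Properties as Bool
open import Data.Bool.Properties using (T-≡; T-∨; ¬-not)
open import Data.Fin using (Fin; zero)
open import Data.Fin.Properties using (any?; all?)
open import Data.Fin.Subset using (Subset; _⊆_; _⊂_; _⊃_; _∪_; ⁅_⁆)
  renaming (_∈_ to _∈ˢ_; _∉_ to _∉ˢ_)
open import Data.Fin.Subset.Induction using (⊃-wellFounded; Acc; acc)
open import Data.Fin.Subset.Properties
  using (_∈?_; x∈p∪q⁻; p⊆p∪q; q⊆p∪q; x∈⁅x⁆; x∈⁅y⁆⇒x≡y)
open import Data.List using ([]; _∷_; map; allFin)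
open import Data.List.Membership.Propositional using () renaming (_∈_ to _∈ˡ_)
open import Data.List.Membership.Propositional.Properties using (∈-allFin)
open import Data.List.Properties using (map-∘)
open import Data.List.Relation.Unary.Any using (here; there)
open import Data.Product using (∃; _,_; proj₁; proj₂)
open import Data.Product.Function.NonDependent.Propositional using (_×-⇔_)
open import Data.Sum using (_⊎_; inj₁; inj₂; [_,_]′)
open import Data.Unit using (⊤; tt)
open import Data.Vec using (lookup)
open import Data.Vec.Properties
  using (lookup∘tabulate; lookup⇒[]=; []=⇒lookup; tabulate-cong; tabulate∘lookup)
open import Function using (_∘_; mk⇔; Equivalence; Injective)
open import Function.Construct.Composition using (_⇔-∘_)
open import Function.Construct.Identity using (⇔-id)
open import Function.Construct.Symmetry using (⇔-sym)
open import Function.Related.TypeIsomorphisms using (¬-cong-⇔)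
open import Level using (0ℓ)
open import Relation.Binary using (Rel; Transitive)
open import Relation.Binary.PropositionalEquality
  using (_≢_; _≗_; refl; sym; trans; cong; subst)
open import Relation.Nullary
  using (¬_; Dec; yes; no; contradiction; _×-dec_; _⊎-dec_; _→-dec_; ¬?)
open import Relation.Nullary.Decidable using (decidable-stable; toWitness; fromWitness; T?)
open import Relation.Nullary.Negation using (negated-stable)
open import Relation.Unary using (Pred; Decidable)

open Equivalence using (to; from)

-- Congruences of logical equivalence.

∀-cong-⇔ : ∀ {X : Set} {P Q : X → Set} → (∀ x → P x ⇔ Q x) →
           (∀ x → P x) ⇔ (∀ x → Q x)
∀-cong-⇔ P⇔Q = mk⇔ (λ p x → to (P⇔Q x) (p x)) (λ q x → from (P⇔Q x) (q x))

-- The second equivalence may assume the first component. Encodings rely on this: their later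
-- conjuncts can be read in the framework only once the first one has placed the set inside `A`.
×-cong-⇔ : ∀ {P P′ Q Q′ : Set} → P ⇔ P′ → (P′ → Q ⇔ Q′) → (P × Q) ⇔ (P′ × Q′)
×-cong-⇔ P⇔P′ Q⇔Q′ = mk⇔
  (λ (p , q) → to P⇔P′ p , to (Q⇔Q′ (to P⇔P′ p)) q)
  (λ (p′ , q′) → from P⇔P′ p′ , from (Q⇔Q′ p′) q′)

⊂-add : ∀ {n} {E : Subset n} {a} → a ∉ˢ E → E ⊂ E ∪ ⁅ a ⁆
⊂-add {E = E} {a} a∉E = p⊆p∪q ⁅ a ⁆ , a , q⊆p∪q E ⁅ a ⁆ (x∈⁅x⁆ a) , a∉E

-- Argumentation: the fundamental lemma and preferred extensions.

module _ {n : ℕ} (F : AF n) where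
  open AF F

  infix 8 _⁺? _⊕?

  _⁺? : ∀ E → Decidable (_⁺ F E)
  (E ⁺?) x = (x ∈? A) ×-dec any? λ y → (y ∈? E) ×-dec T? (R y x)

  _⊕? : ∀ E → Decidable (_⊕ F E)
  (E ⊕?) x = (x ∈? E) ⊎-dec (E ⁺?) x

  defends? : ∀ E → Decidable (Defends F E)
  defends? E a = all? λ x → (x ∈? A) →-dec (T? (R x a) →-dec (E ⁺?) x)

  ⁺-mono : ∀ {E E′} → E ⊆ E′ → ∀ {x} → (_⁺ F E) x → (_⁺ F E′) x
  ⁺-mono E⊆E′ (x∈A , y , y∈E , yRx) = x∈A , y , E⊆E′ y∈E , yRx

  defends-mono : ∀ {E E′ a} → E ⊆ E′ → Defends F E a → Defends F E′ a
  defends-mono E⊆E′ def x x∈A xRa = ⁺-mono E⊆E′ (def x x∈A xRa)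

  conflictFree-⊆ : ∀ {E E′} → E ⊆ E′ → ConflictFree F E′ → ConflictFree F E
  conflictFree-⊆ E⊆E′ (E′⊆A , cf) =
    E′⊆A ∘ E⊆E′ , λ x (x∈E , x∈E⁺) → cf x (E⊆E′ x∈E , ⁺-mono E⊆E′ x∈E⁺)

  complete⇒admissible : ∀ {E} → IsComplete F E → IsAdmissible F E
  complete⇒admissible (cf@(E⊆A , _) , fix) = cf , λ a a∈E → to (fix a (E⊆A a∈E)) a∈E

  defended⇒admissible : ∀ {E E′} → IsAdmissible F E → E ⊆ E′ → E′ ⊆ A →
                        (∀ a → a ∈ˢ E′ → Defends F E a) → IsAdmissible F E′
  defended⇒admissible ((_ , cf) , _) E⊆E′ E′⊆A def =
    (E′⊆A , conflict) , λ a a∈E′ → defends-mono E⊆E′ (def a a∈E′)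
    where
    -- An attack y → x inside E′ is countered by some z ∈ E attacking y, and E
    -- in turn counters z because it defends y: a conflict within E.
    conflict : ∀ x → ¬ (x ∈ˢ _ × (_⁺ F _) x)
    conflict x (x∈E′ , x∈A , y , y∈E′ , yRx)
      with _ , z , z∈E , zRy ← def x x∈E′ y (E′⊆A y∈E′) yRx =
      cf z (z∈E , def y y∈E′ z (proj₁ (R⊆A×A zRy)) zRy)

  -- Dung's fundamental lemma for a single argument: `E` defends its own members and `a`, hence
  -- every member of the union.
  add-defended : ∀ {E a} → IsAdmissible F E → a ∈ˢ A → Defends F E a →
                 IsAdmissible F (E ∪ ⁅ a ⁆)
  add-defended {E} {a} adm@((E⊆A , _) , defE) a∈A defa =
    defended⇒admissible adm (p⊆p∪q ⁅ a ⁆) (λ {x} → member x (_∈ˢ A) (λ _ → E⊆A) a∈A)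
      (λ x → member x (Defends F E) defE defa)
    where
    member : ∀ x (P : Pred (Fin n) 0ℓ) → (∀ y → y ∈ˢ E → P y) → P a →
             x ∈ˢ E ∪ ⁅ a ⁆ → P x
    member x P pE pa x∈ =
      [ pE x , (λ x∈a → subst P (sym (x∈⁅y⁆⇒x≡y a x∈a)) pa) ]′ (x∈p∪q⁻ E ⁅ a ⁆ x∈)

  -- Missing defended arguments are added one at a time. Each addition enlarges a subset of a finite
  -- set, so the process stops, and it stops only when nothing defended is missing.
  admissible⇒⊆complete : ∀ {E} → IsAdmissible F E → ∃[ C ] (IsComplete F C × E ⊆ C)
  admissible⇒⊆complete {E} = go (⊃-wellFounded E)
    where
    go : ∀ {E} → Acc _⊃_ E → IsAdmissible F E → ∃[ C ] (IsComplete F C × E ⊆ C)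
    go {E} (acc rec) adm@(cf , def)
      with any? (λ a → (a ∈? A) ×-dec (defends? E a ×-dec ¬? (a ∈? E)))
    ... | yes (a , a∈A , defa , a∉E) =
      let C , complete , E∪a⊆C = go (rec (⊂-add a∉E)) (add-defended adm a∈A defa)
      in C , complete , E∪a⊆C ∘ p⊆p∪q ⁅ a ⁆
    ... | no closed =
      E , (cf , λ a a∈A → mk⇔ (def a) λ defa →
        decidable-stable (a ∈? E) λ a∉E → closed (a , a∈A , defa , a∉E)) , λ x∈E → x∈E

  -- Bridges the formula `Preferred`, which maximises over admissible sets, and `IsPreferred`, which
  -- maximises over complete ones. A maximal admissible set omits no argument it defends, since it
  -- could grow by it; conversely, a strictly larger admissible set lies inside a complete one.
  maximalAdmissible⇔preferred : ∀ {E} → Maximal _⊂_ (IsAdmissible F) E ⇔ IsPreferred F E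
  maximalAdmissible⇔preferred {E} = mk⇔ preferred maximal
    where
    preferred : Maximal _⊂_ (IsAdmissible F) E → IsPreferred F E
    preferred (adm@(cf , def) , max) =
      (cf , λ a a∈A → mk⇔ (def a) λ defa → decidable-stable (a ∈? E) λ a∉E →
        max _ (add-defended adm a∈A defa) (⊂-add a∉E)) ,
      λ C complete → max C (complete⇒admissible complete)

    maximal : IsPreferred F E → Maximal _⊂_ (IsAdmissible F) E
    maximal (complete , max) = complete⇒admissible complete ,
      λ E′ adm (E⊆E′ , x , x∈E′ , x∉E) →
        let C , complete′ , E′⊆C = admissible⇒⊆complete adm
        in max C complete′ (E′⊆C ∘ E⊆E′ , x , E′⊆C x∈E′ , x∉E)

in°-injective : ∀ {n} → Injective _≡_ _≡_ (in° {n})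
in°-injective refl = refl

in′-injective : ∀ {n} → Injective _≡_ _≡_ (in′ {n})
in′-injective refl = refl

-- Constructive reading of the classical connectives.

module _ {n : ℕ} (L : Vocabulary n) where
  open Vocabulary L
  open DL-PA L

  -- Atoms are decidable, negations are always stable, and conjunctions and boxes inherit stability
  -- from their subformulas.
  ⊨-stable : ∀ φ {v} → ¬ ¬ (v ⊨ φ) → v ⊨ φ
  ⊨-stable (atom p)  {v} = decidable-stable (T? (v p))
  ⊨-stable (¬ᶠ φ)        = negated-stable
  ⊨-stable (φ ∧ᶠ ψ) ¬¬∧  = ⊨-stable φ (λ ¬φ → ¬¬∧ (¬φ ∘ proj₁)) ,
                           ⊨-stable ψ (λ ¬ψ → ¬¬∧ (¬ψ ∘ proj₂))
  ⊨-stable ([ π ] φ) ¬¬□ w vπw = ⊨-stable φ λ ¬φ → ¬¬□ λ □φ → ¬φ (□φ w vπw)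

  ⊨-⊤ : ∀ {v} → v ⊨ ⊤ᶠ
  ⊨-⊤ (p , ¬p) = ¬p p

  ⊨-⇒ : ∀ v φ ψ {P Q : Set} → v ⊨ φ ⇔ P → (P → v ⊨ ψ ⇔ Q) → v ⊨ (φ ⇒ᶠ ψ) ⇔ (P → Q)
  ⊨-⇒ v φ ψ φ⇔P ψ⇔Q = mk⇔
    (λ φ⇒ψ p → to (ψ⇔Q p) (⊨-stable ψ λ ¬ψ → φ⇒ψ (from φ⇔P p , ¬ψ)))
    (λ P→Q (hφ , ¬ψ) → let p = to φ⇔P hφ in ¬ψ (from (ψ⇔Q p) (P→Q p)))

  ⊨-∨ : ∀ v φ ψ {P Q : Set} → Dec P → Dec Q → v ⊨ φ ⇔ P → v ⊨ ψ ⇔ Q →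
        v ⊨ (φ ∨ᶠ ψ) ⇔ (P ⊎ Q)
  ⊨-∨ v φ ψ P? Q? φ⇔P ψ⇔Q = mk⇔
    (λ φ∨ψ → decidable-stable (P? ⊎-dec Q?) λ ¬P⊎Q →
      φ∨ψ (¬P⊎Q ∘ inj₁ ∘ to φ⇔P , ¬P⊎Q ∘ inj₂ ∘ to ψ⇔Q))
    (λ P⊎Q (¬φ , ¬ψ) → [ ¬φ ∘ from φ⇔P , ¬ψ ∘ from ψ⇔Q ]′ P⊎Q)

  ⊨-⇔ᶠ : ∀ v φ ψ {P Q : Set} → v ⊨ φ ⇔ P → v ⊨ ψ ⇔ Q → v ⊨ (φ ⇔ᶠ ψ) ⇔ (P ⇔ Q)
  ⊨-⇔ᶠ v φ ψ φ⇔P ψ⇔Q =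
    mk⇔ (λ (f , g) → mk⇔ f g) (λ P⇔Q → to P⇔Q , from P⇔Q) ⇔-∘
    (⊨-⇒ v φ ψ φ⇔P (λ _ → ψ⇔Q) ×-⇔ ⊨-⇒ v ψ φ ψ⇔Q (λ _ → φ⇔P))

  ⊨-⋀ : ∀ {v} {f : Fin n → Formula} {P : Fin n → Set} → (∀ x → v ⊨ f x ⇔ P x) →
        v ⊨ ⋀ f ⇔ (∀ x → P x)
  ⊨-⋀ {v} {f} f⇔P = ∀-cong-⇔ f⇔P ⇔-∘
    mk⇔ (λ h x → elim (allFin n) h (∈-allFin x)) (λ h → intro (allFin n) h)
    where
    elim : ∀ xs → v ⊨ fold₁ _∧ᶠ_ ⊤ᶠ (map f xs) → ∀ {x} → x ∈ˡ xs → v ⊨ f x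
    elim (_ ∷ [])     h       (here refl) = h
    elim (_ ∷ _ ∷ _)  (h , _) (here refl) = h
    elim (_ ∷ y ∷ xs) (_ , h) (there x∈) = elim (y ∷ xs) h x∈

    intro : ∀ xs → (∀ x → v ⊨ f x) → v ⊨ fold₁ _∧ᶠ_ ⊤ᶠ (map f xs)
    intro []           h = ⊨-⊤ {v}
    intro (x ∷ [])     h = h x
    intro (x ∷ y ∷ xs) h = h x , intro (y ∷ xs) h

  -- A disjunction is a negated conjunction and by itself only refutes the absence of a witness;
  -- decidability of `P` on a finite type then finds one.
  ⊨-⋁ : ∀ {v} {f : Fin n → Formula} {P : Fin n → Set} → Decidable P →
        (∀ x → v ⊨ f x ⇔ P x) → v ⊨ ⋁ f ⇔ ∃ P
  ⊨-⋁ {v} {f} {P} P? f⇔P = mk⇔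
    (λ h → decidable-stable (any? P?) λ ¬∃ →
      elim (allFin n) h λ x fx → ¬∃ (x , to (f⇔P x) fx))
    (λ (x , px) → intro (allFin n) (∈-allFin x) (from (f⇔P x) px))
    where
    elim : ∀ xs → v ⊨ fold₁ _∨ᶠ_ ⊥ᶠ (map f xs) → ¬ (∀ x → ¬ (v ⊨ f x))
    elim []           (p , ¬p) none = ¬p p
    elim (x ∷ [])     h        none = none x h
    elim (x ∷ y ∷ xs) h        none = h (none x , λ h′ → elim (y ∷ xs) h′ none)

    intro : ∀ xs {x} → x ∈ˡ xs → v ⊨ f x → v ⊨ fold₁ _∨ᶠ_ ⊥ᶠ (map f xs)
    intro (_ ∷ [])     (here refl) fx         = fx
    intro (_ ∷ _ ∷ _)  (here refl) fx (¬f , _) = ¬f fx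
    intro (_ ∷ y ∷ xs) (there x∈) fx (_ , ¬f) = ¬f (intro (y ∷ xs) x∈ fx)

  -- Assignments and valuations differing on one family of variables.

  assign-same : ∀ v p b → (v [ p ↦ b ]) p ≡ b
  assign-same v p b with p ≟ p
  ... | yes _  = refl
  ... | no p≢p = contradiction refl p≢p

  assign-other : ∀ v {p q} b → q ≢ p → (v [ p ↦ b ]) q ≡ v q
  assign-other v {p} {q} b q≢p with q ≟ p
  ... | yes q≡p = contradiction q≡p q≢p
  ... | no _    = refl

  assign-cong : ∀ {v w} → v ≗ w → ∀ p b → v [ p ↦ b ] ≗ w [ p ↦ b ]
  assign-cong v≗w p b q with q ≟ p
  ... | yes _ = refl
  ... | no _  = v≗w q

  assign-id : ∀ v p → v [ p ↦ v p ] ≗ v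
  assign-id v p q with q ≟ p
  ... | yes refl = refl
  ... | no _     = refl

  assign-toward : ∀ (v w : Valuation) p q →
    (v [ p ↦ w p ]) q ≡ w q ⊎ (q ≢ p × (v [ p ↦ w p ]) q ≡ v q)
  assign-toward v w p q with q ≟ p
  ... | yes refl = inj₁ refl
  ... | no q≢p   = inj₂ (q≢p , refl)

  infix 4 _≈[_]_

  _≈[_]_ : Valuation → (Fin n → Var n) → Valuation → Set
  v ≈[ t ] w = ∀ p → (∀ x → p ≢ var (t x)) → w p ≡ v p

  ≈-trans : ∀ {t u v w} → u ≈[ t ] v → v ≈[ t ] w → u ≈[ t ] w
  ≈-trans u≈v v≈w p p∉t = trans (v≈w p p∉t) (u≈v p p∉t)

  ≈-assign : ∀ {t v w x b} → w ≗ v [ var (t x) ↦ b ] → v ≈[ t ] w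
  ≈-assign {v = v} {x = x} {b} w≗ p p∉t = trans (w≗ p) (assign-other v b (p∉t x))

  -- Turns a subset of arguments into a state; it supplies the witness whenever a program must reach
  -- a given extension.
  overwrite : (Fin n → Var n) → Subset n → Valuation → Valuation
  overwrite t E v p with any? (λ x → p ≟ var (t x))
  ... | yes (x , _) = lookup E x
  ... | no _        = v p

  ≈-overwrite : ∀ t E v → v ≈[ t ] overwrite t E v
  ≈-overwrite t E v p p∉t with any? (λ x → p ≟ var (t x))
  ... | yes (x , p≡) = contradiction p≡ (p∉t x)
  ... | no _         = refl

  overwrite-lookup : ∀ t E v → Injective _≡_ _≡_ t → ∀ x →
                     overwrite t E v (var (t x)) ≡ lookup E x
  overwrite-lookup t E v t-inj x with any? (λ y → var (t x) ≟ var (t y))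
  ... | yes (y , eq) = cong (lookup E) (sym (t-inj (var-injective eq)))
  ... | no ¬∃        = contradiction (x , refl) ¬∃

  subsetOf-overwrite : ∀ t E v → Injective _≡_ _≡_ t → subsetOf t (overwrite t E v) ≡ E
  subsetOf-overwrite t E v t-inj =
    trans (tabulate-cong (overwrite-lookup t E v t-inj)) (tabulate∘lookup E)

  ∈-subsetOf : ∀ t v x → T (v (var (t x))) ⇔ x ∈ˢ subsetOf t v
  ∈-subsetOf t v x = mk⇔
    (λ h → lookup⇒[]= x _ (trans (lookup∘tabulate _ x) (to T-≡ h)))
    (λ h → from T-≡ (trans (sym (lookup∘tabulate _ x)) ([]=⇒lookup h)))

  subsetOf-≈ : ∀ {t t′ v w} → v ≈[ t ] w → (∀ x y → t′ x ≢ t y) →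
               subsetOf t′ w ≡ subsetOf t′ v
  subsetOf-≈ v≈w t′≢t =
    tabulate-cong λ x → v≈w _ λ y eq → t′≢t x y (var-injective eq)

  -- Guarded assignments, iterated choice and iterated sequence.

  guarded : ∀ φ π {v w} → v ⊨ φ → ∥ π ∥ v w → ∥ φ ⁇ ⨾ π ∥ v w
  guarded φ π v⊨φ vπw = _ , ((λ _ → refl) , v⊨φ) , vπw

  -- A test may move to an extensionally equal valuation `u`; assignment respects `_≗_`, which
  -- eliminates `u`.
  assign-unguard : ∀ {P : Set} {p b v w} →
    ∃[ u ] ((v ≗ u × P) × w ≗ u [ p ↦ b ]) → P × w ≗ v [ p ↦ b ]
  assign-unguard {p = p} {b} (u , (v≗u , vP) , w≗) =
    vP , λ q → trans (w≗ q) (sym (assign-cong v≗u p b q))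

  module _ {X : Set} {π : X → Program} where

    -- The membership hypothesis excludes the empty list, whose choice is `skip`.
    Choice⁻ : ∀ {x₀ xs} → x₀ ∈ˡ xs → ∀ {v w} → ∥ Choice (map π xs) ∥ v w → ∃[ x ] ∥ π x ∥ v w
    Choice⁻ {xs = x ∷ []}     _ vπw        = x , vπw
    Choice⁻ {xs = x ∷ y ∷ xs} _ (inj₁ vπw) = x , vπw
    Choice⁻ {xs = x ∷ y ∷ xs} _ (inj₂ vπw) = Choice⁻ {xs = y ∷ xs} (here refl) vπw

    Choice⁺ : ∀ {x xs} → x ∈ˡ xs → ∀ {v w} → ∥ π x ∥ v w → ∥ Choice (map π xs) ∥ v w
    Choice⁺ {xs = _ ∷ []}     (here refl) vπw = vπw
    Choice⁺ {xs = _ ∷ _ ∷ _}  (here refl) vπw = inj₁ vπw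
    Choice⁺ {xs = _ ∷ y ∷ xs} (there x∈)  vπw = inj₂ (Choice⁺ x∈ vπw)

    module _ (S : Rel Valuation 0ℓ) (S-refl : ∀ {v w} → v ≗ w → S v w)
             (S-trans : Transitive S) (π⊆S : ∀ x {v w} → ∥ π x ∥ v w → S v w) where

      Seq-⊆ : ∀ xs {v w} → ∥ Seq (map π xs) ∥ v w → S v w
      Seq-⊆ []           (v≗w , _)       = S-refl v≗w
      Seq-⊆ (x ∷ [])     vπw             = π⊆S x vπw
      Seq-⊆ (x ∷ y ∷ xs) (u , vπu , uw)  = S-trans (π⊆S x vπu) (Seq-⊆ (y ∷ xs) uw)

      -- Isolates the step of one component in a run, while `S` records what the components before
      -- and after it can have done.
      Seq-visits : ∀ {x xs} → x ∈ˡ xs → ∀ {v w} → ∥ Seq (map π xs) ∥ v w →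
                   ∃[ u ] ∃[ u′ ] (S v u × ∥ π x ∥ u u′ × S u′ w)
      Seq-visits {xs = _ ∷ []} (here refl) vπw =
        _ , _ , S-refl (λ _ → refl) , vπw , S-refl (λ _ → refl)
      Seq-visits {xs = _ ∷ y ∷ xs} (here refl) (u , vπu , uw) =
        _ , _ , S-refl (λ _ → refl) , vπu , Seq-⊆ (y ∷ xs) uw
      Seq-visits {xs = x ∷ y ∷ xs} (there x∈) (u , vπu , uw)
        with u₁ , u₂ , uu₁ , step , u₂w ← Seq-visits x∈ uw =
        u₁ , u₂ , S-trans (π⊆S x vπu) uu₁ , step , u₂w

    -- To reach w, each component assigns to its own variable the final value.
    Seq-reaches : {t : X → Prp} (Inv : Rel Valuation 0ℓ) →
      (∀ x {v w u} → Inv v w → u ≗ v [ t x ↦ w (t x) ] → ∥ π x ∥ v u) →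
      (∀ x {v w} → Inv v w → Inv (v [ t x ↦ w (t x) ]) w) →
      ∀ xs {v w} → Inv v w → (∀ p → (∀ x → x ∈ˡ xs → p ≢ t x) → w p ≡ v p) →
      ∥ Seq (map π xs) ∥ v w
    Seq-reaches {t} Inv step keep = go
      where
      settle : ∀ {x xs} {v w : Valuation} → (∀ p → (∀ y → y ∈ˡ x ∷ xs → p ≢ t y) → w p ≡ v p) →
               ∀ p → (∀ y → y ∈ˡ xs → p ≢ t y) → w p ≡ (v [ t x ↦ w (t x) ]) p
      settle {x} {v = v} {w} agree p p∉ with assign-toward v w (t x) p
      ... | inj₁ ≡w         = sym ≡w
      ... | inj₂ (p≢ , ≡v) = trans
        (agree p λ { _ (here refl) → p≢ ; y (there y∈) → p∉ y y∈ }) (sym ≡v)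

      go : ∀ xs {v w} → Inv v w → (∀ p → (∀ x → x ∈ˡ xs → p ≢ t x) → w p ≡ v p) →
           ∥ Seq (map π xs) ∥ v w
      go []           {v} inv agree = (λ p → sym (agree p λ _ ())) , ⊨-⊤ {v}
      go (x ∷ [])     inv agree = step x inv λ p → settle agree p λ _ ()
      go (x ∷ y ∷ xs) inv agree =
        _ , step x inv (λ _ → refl) , go (y ∷ xs) (keep x inv) (settle agree)

  -- The relations denoted by `vary` and `copy`.

  IN-map : (π : Prp → Program) → map (λ x → π (var (in° x))) (allFin n) ≡ map π IN
  IN-map π = map-∘ (allFin n)

  vary-⇔ : ∀ v w → ∥ vary IN ∥ v w ⇔ v ≈[ in° ] w
  vary-⇔ v w = subst (λ πs → ∥ Seq πs ∥ v w ⇔ v ≈[ in° ] w) (IN-map _) (mk⇔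
    (Seq-⊆ (_≈[ in° ]_) (λ v≗w p _ → sym (v≗w p)) ≈-trans
      (λ x → [ ≈-assign , ≈-assign ]′) (allFin n))
    (λ v≈w → Seq-reaches (λ _ _ → ⊤) step (λ _ _ → tt) (allFin n) tt
      λ p p∉ → v≈w p λ x → p∉ x (∈-allFin x)))
    where
    step : ∀ x {v w u : Valuation} → ⊤ → u ≗ v [ var (in° x) ↦ w (var (in° x)) ] →
           ∥ +ᵖ var (in° x) ∪ᵖ -ᵖ var (in° x) ∥ v u
    step x {w = w} _ u≗ with w (var (in° x))
    ... | true  = inj₁ u≗
    ... | false = inj₂ u≗

  copy-⇔ : ∀ v w → ∥ copy ∥ v w ⇔
           (v ≈[ in′ ] w × (∀ x → w (var (in′ x)) ≡ v (var (in° x))))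
  copy-⇔ v w = mk⇔ sound complete
    where
    -- Each component copies a single variable, so a relation that holds of every component and
    -- composes must also allow an `in′` variable to be still untouched.
    S : Rel Valuation 0ℓ
    S v w = v ≈[ in′ ] w × (∀ x → w (var (in′ x)) ≡ v (var (in′ x)) ⊎
                                  w (var (in′ x)) ≡ v (var (in° x)))

    in°-kept : ∀ {v w} → v ≈[ in′ ] w → ∀ x → w (var (in° x)) ≡ v (var (in° x))
    in°-kept v≈w x = v≈w _ λ y eq → contradiction (var-injective eq) λ ()

    S-refl : ∀ {v w} → v ≗ w → S v w
    S-refl v≗w = (λ p _ → sym (v≗w p)) , λ x → inj₁ (sym (v≗w _))

    S-trans : Transitive S
    S-trans {u} {v} {w} (u≈v , uv) (v≈w , vw) = ≈-trans u≈v v≈w , λ x →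
      [ (λ eq → [ inj₁ ∘ trans eq , inj₂ ∘ trans eq ]′ (uv x))
      , (λ eq → inj₂ (trans eq (in°-kept u≈v x))) ]′ (vw x)

    copyOne⁻ : ∀ x {v w} → ∥ copyOne x ∥ v w →
               w ≗ v [ var (in′ x) ↦ v (var (in° x)) ]
    copyOne⁻ x {v} (inj₁ run) with h , w≗ ← assign-unguard run
      rewrite to T-≡ h = w≗
    copyOne⁻ x {v} (inj₂ run) with h , w≗ ← assign-unguard run
      rewrite ¬-not {v (var (in° x))} (h ∘ from T-≡) = w≗

    copyOne⊆S : ∀ x {v w} → ∥ copyOne x ∥ v w → S v w
    copyOne⊆S x {v} run = ≈-assign w≗ , copied
      where
      w≗ = copyOne⁻ x run
      copied : ∀ y → _
      copied y with var (in′ y) ≟ var (in′ x)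
      ... | yes eq rewrite in′-injective (var-injective eq) =
        inj₂ (trans (w≗ _) (assign-same v _ _))
      ... | no neq = inj₁ (trans (w≗ _) (assign-other v _ neq))

    sound : ∥ copy ∥ v w → v ≈[ in′ ] w × (∀ x → w (var (in′ x)) ≡ v (var (in° x)))
    sound run = proj₁ (Seq-⊆ S S-refl S-trans copyOne⊆S (allFin n) run) , copied
      where
      copied : ∀ x → w (var (in′ x)) ≡ v (var (in° x))
      copied x
        with u , u′ , (v≈u , _) , step , (_ , u′w) ←
               Seq-visits S S-refl S-trans copyOne⊆S (∈-allFin x) run
        with u′≗ ← copyOne⁻ x step =
        -- Later components either leave `in′ x` alone or copy `in° x` anew; both give the initial
        -- value, as the `in°` variables are constant along the run.
        [ (λ eq → trans eq (trans (trans (u′≗ _) (assign-same u _ _)) (in°-kept v≈u x)))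
        , (λ eq → trans eq (trans (in°-kept (≈-assign u′≗) x) (in°-kept v≈u x)))
        ]′ (u′w x)

    Inv : Rel Valuation 0ℓ
    Inv v w = ∀ x → w (var (in′ x)) ≡ v (var (in° x))

    copyOne⁺ : ∀ x {v u} b → v (var (in° x)) ≡ b → u ≗ v [ var (in′ x) ↦ b ] →
               ∥ copyOne x ∥ v u
    copyOne⁺ x true  eq u≗ = inj₁ (guarded (𝚒𝚗 x) (+ᵖ _) (from T-≡ eq) u≗)
    copyOne⁺ x false eq u≗ = inj₂ (guarded (¬ᶠ 𝚒𝚗 x) (-ᵖ _) (subst T eq) u≗)

    step : ∀ x {v w u} → Inv v w → u ≗ v [ var (in′ x) ↦ w (var (in′ x)) ] →
           ∥ copyOne x ∥ v u
    step x inv = copyOne⁺ x _ (sym (inv x))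

    complete : v ≈[ in′ ] w × Inv v w → ∥ copy ∥ v w
    complete (v≈w , inv) = Seq-reaches Inv step
      (λ x {v} {w} inv y →
        trans (inv y) (sym (in°-kept (≈-assign {v = v} {x = x} λ _ → refl) y)))
      (allFin n) inv λ p p∉ → v≈w p λ x → p∉ x (∈-allFin x)

  -- Strict enlargement and shrinking of the encoded set.

  module _ (b : Bool) where

    -- For `b = true` the second component is the inclusion of `𝖤 v` in `𝖤 w`, for `b = false` the
    -- reverse one, so a single proof serves both directions.
    Shift : Rel Valuation 0ℓ
    Shift v w = v ≈[ in° ] w × (∀ x → v (var (in° x)) ≡ b → w (var (in° x)) ≡ b)

    shift-trans : Transitive Shift
    shift-trans (u≈v , uv) (v≈w , vw) = ≈-trans u≈v v≈w , λ x → vw x ∘ uv x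

    shift-assign : ∀ {v w x} → w ≗ v [ var (in° x) ↦ b ] → Shift v w
    shift-assign {v} {w} {x} w≗ = ≈-assign w≗ , λ y vy → trans (w≗ _) (keep y vy)
      where
      keep : ∀ y → v (var (in° y)) ≡ b → (v [ var (in° x) ↦ b ]) (var (in° y)) ≡ b
      keep y vy with var (in° y) ≟ var (in° x)
      ... | yes _ = refl
      ... | no _  = vy

    shift-toward : ∀ x {v w} → Shift v w → Shift (v [ var (in° x) ↦ w (var (in° x)) ]) w
    shift-toward x {v} {w} (v≈w , vw) =
      (λ p p∉ → trans (v≈w p p∉) (sym (assign-other v _ (p∉ x)))) ,
      λ y → [ (λ ≡w uy → trans (sym ≡w) uy) , (λ (_ , ≡v) uy → vw y (trans (sym ≡v) uy)) ]′
              (assign-toward v w (var (in° x)) (var (in° y)))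

    module _ (some : Prp → Program)
             (some-⇔ : ∀ p v w → ∥ some p ∥ v w ⇔ (w ≗ v [ p ↦ b ] ⊎ v ≗ w)) where

      some*-⇔ : ∀ v w → ∥ Seq (map some IN) ∥ v w ⇔ Shift v w
      some*-⇔ v w = subst (λ πs → ∥ Seq πs ∥ v w ⇔ Shift v w) (IN-map some) (mk⇔
        (Seq-⊆ Shift shift-refl shift-trans
          (λ x run → [ shift-assign , shift-refl ]′ (to (some-⇔ _ _ _) run)) (allFin n))
        (λ vw → Seq-reaches Shift step (λ x → shift-toward x) (allFin n) vw
          λ p p∉ → proj₁ vw p λ x → p∉ x (∈-allFin x)))
        where
        shift-refl : ∀ {v w} → v ≗ w → Shift v w
        shift-refl v≗w = (λ p _ → sym (v≗w p)) , λ x vx → trans (sym (v≗w _)) vx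

        step : ∀ x {v w u} → Shift v w → u ≗ v [ var (in° x) ↦ w (var (in° x)) ] →
               ∥ some (var (in° x)) ∥ v u
        step x {v} {w} {u} (_ , vw) u≗ with w (var (in° x)) Bool.≟ b
        ... | yes wx = from (some-⇔ _ v u)
          (inj₁ (subst (λ c → u ≗ v [ var (in° x) ↦ c ]) wx u≗))
        -- By `vw` the old value is not `b` either. Both values are thus `not b`, the assignment
        -- changes nothing, and the component can skip.
        ... | no ¬wx = from (some-⇔ _ v u) (inj₂ λ p → sym (trans
          (subst (λ c → u ≗ v [ var (in° x) ↦ c ])
            (trans (¬-not ¬wx) (sym (¬-not (¬wx ∘ vw x)))) u≗ p)
          (assign-id v _ p)))

    module _ .{{_ : NonZero n}} (one : Prp → Program)
             (one-⇔ : ∀ p v w → ∥ one p ∥ v w ⇔ (v p ≡ not b × w ≗ v [ p ↦ b ])) where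

      -- `NonZero n` makes this a choice between actual flips; over no arguments it would be `skip`,
      -- which flips nothing.
      one*-⇔ : ∀ v w → ∥ Choice (map one IN) ∥ v w ⇔
               (∃[ x ] (v (var (in° x)) ≡ not b × w ≗ v [ var (in° x) ↦ b ]))
      one*-⇔ v w = subst (λ πs → ∥ Choice πs ∥ v w ⇔ _) (IN-map one) (mk⇔
        (λ run → let x , step = Choice⁻ (∈-allFin (first n)) run in x , to (one-⇔ _ v w) step)
        (λ (x , h) → Choice⁺ (∈-allFin x) (from (one-⇔ _ v w) h)))
        where
        first : ∀ m .{{_ : NonZero m}} → Fin m
        first (ℕ.suc m) = zero

      module _ (some : Prp → Program)
               (some-⇔ : ∀ p v w → ∥ some p ∥ v w ⇔ (w ≗ v [ p ↦ b ] ⊎ v ≗ w)) where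

        -- The first program flips some variable to `b` and the second cannot undo it, whence
        -- strictness. Conversely, the variable witnessing strictness is flipped first, and what
        -- remains is still a shift toward `w`.
        one-some*-⇔ : ∀ v w → ∥ Choice (map one IN) ⨾ Seq (map some IN) ∥ v w ⇔
          (Shift v w × ∃[ x ] (v (var (in° x)) ≡ not b × w (var (in° x)) ≡ b))
        one-some*-⇔ v w = mk⇔
          (λ (u , vu , uw) →
            let x , vx , u≗ = to (one*-⇔ v u) vu
                shift       = to (some*-⇔ some some-⇔ u w) uw
            in shift-trans (shift-assign u≗) shift , x , vx ,
               proj₂ shift x (trans (u≗ _) (assign-same v _ b)))
          (λ (shift , x , vx , wx) →
            _ , from (one*-⇔ v _) (x , vx , λ p → cong (λ c → (v [ _ ↦ c ]) p) wx) ,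
            from (some*-⇔ some some-⇔ _ w) (shift-toward x shift))

  trueOne-⇔ : ∀ p v w → ∥ (¬ᶠ atom p) ⁇ ⨾ +ᵖ p ∥ v w ⇔ (v p ≡ false × w ≗ v [ p ↦ true ])
  trueOne-⇔ p v w = mk⇔
    (λ run → let h , w≗ = assign-unguard run in ¬-not (h ∘ from T-≡) , w≗)
    (λ (vp , w≗) → guarded (¬ᶠ atom p) (+ᵖ p) {w = w} (subst T vp) w≗)

  falseOne-⇔ : ∀ p v w → ∥ atom p ⁇ ⨾ -ᵖ p ∥ v w ⇔ (v p ≡ true × w ≗ v [ p ↦ false ])
  falseOne-⇔ p v w = mk⇔
    (λ run → let h , w≗ = assign-unguard run in to T-≡ h , w≗)
    (λ (vp , w≗) → guarded (atom p) (-ᵖ p) {w = w} (from T-≡ vp) w≗)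

  orSkip-⇔ : ∀ {P : Set} v w → (P ⊎ ∥ skip ∥ v w) ⇔ (P ⊎ v ≗ w)
  orSkip-⇔ v w = mk⇔ [ inj₁ , inj₂ ∘ proj₁ ]′ [ inj₁ , (λ v≗w → inj₂ (v≗w , ⊨-⊤ {v})) ]′

  ∈𝖤-⇔ : ∀ v x → v (var (in° x)) ≡ true ⇔ x ∈ˢ 𝖤 v
  ∈𝖤-⇔ v x = ∈-subsetOf in° v x ⇔-∘ ⇔-sym T-≡

  ∉𝖤-⇔ : ∀ v x → v (var (in° x)) ≡ false ⇔ x ∉ˢ 𝖤 v
  ∉𝖤-⇔ v x = mk⇔
    (λ vx x∈ → contradiction (trans (sym vx) (from (∈𝖤-⇔ v x) x∈)) λ ())
    (λ x∉ → ¬-not (x∉ ∘ to (∈𝖤-⇔ v x)))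

  enlarge-⇔ : .{{_ : NonZero n}} → ∀ v w → ∥ mkTrueOne IN ⨾ mkTrueSome IN ∥ v w ⇔
              (v ≈[ in° ] w × 𝖤 v ⊂ 𝖤 w)
  enlarge-⇔ v w =
    mk⇔
      (λ ((v≈w , vw) , x , vx , wx) → v≈w ,
        (λ {y} y∈ → to (∈𝖤-⇔ w y) (vw y (from (∈𝖤-⇔ v y) y∈))) ,
        x , to (∈𝖤-⇔ w x) wx , to (∉𝖤-⇔ v x) vx)
      (λ (v≈w , v⊆w , x , x∈ , x∉) →
        (v≈w , λ y vy → from (∈𝖤-⇔ w y) (v⊆w (to (∈𝖤-⇔ v y) vy))) ,
        x , from (∉𝖤-⇔ v x) x∉ , from (∈𝖤-⇔ w x) x∈)
    ⇔-∘ one-some*-⇔ true _ trueOne-⇔ _ (λ _ _ _ → orSkip-⇔ _ _) v w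

  shrink-⇔ : .{{_ : NonZero n}} → ∀ v w → ∥ mkFalseOne IN ⨾ mkFalseSome IN ∥ v w ⇔
             (v ≈[ in° ] w × 𝖤 v ⊃ 𝖤 w)
  shrink-⇔ v w =
    mk⇔
      (λ ((v≈w , vw) , x , vx , wx) → v≈w ,
        -- A shift toward `false` keeps non-members out; the inclusion is its contrapositive.
        (λ {y} y∈ → decidable-stable (y ∈? 𝖤 v) λ y∉ →
          to (∉𝖤-⇔ w y) (vw y (from (∉𝖤-⇔ v y) y∉)) y∈) ,
        x , to (∈𝖤-⇔ v x) vx , to (∉𝖤-⇔ w x) wx)
      (λ (v≈w , w⊆v , x , x∈ , x∉) →
        (v≈w , λ y vy → from (∉𝖤-⇔ w y) (to (∉𝖤-⇔ v y) vy ∘ w⊆v)) ,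
        x , from (∈𝖤-⇔ v x) x∈ , from (∉𝖤-⇔ w x) x∉)
    ⇔-∘ one-some*-⇔ false _ falseOne-⇔ _ (λ _ _ _ → orSkip-⇔ _ _) v w

  -- Basic formulas interpreted in a fixed framework.

  attacked range : (Fin n → Var n) → Fin n → Formula
  attacked t x = ⋁ λ y → atom (var (t y)) ∧ᶠ 𝚛 y x
  range t x = atom (var (t x)) ∨ᶠ (𝚊𝚠 x ∧ᶠ attacked t x)

  module _ (F : AF n) where
    open AF F

    -- Formulas are interpreted over a fixed F rather than over frame v, so that
    -- F survives the changes to the in and in′ variables.
    record Represents (v : Valuation) : Set where
      field
        aw-⇔ : ∀ x → T (v (var (aw x))) ⇔ x ∈ˢ A
        r-⇔  : ∀ x y → ((x ∈ˢ A × y ∈ˢ A) × T (v (var (r x y)))) ⇔ T (R x y)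

    open Represents

    represents-≈ : ∀ {t v w} → (∀ x y → aw x ≢ t y) → (∀ x y z → r x y ≢ t z) →
                   Represents v → v ≈[ t ] w → Represents w
    represents-≈ {t} {v} {w} aw≢ r≢ rep v≈w = record
      { aw-⇔ = λ x → subst (λ b → T b ⇔ _) (sym (same (aw≢ x))) (aw-⇔ rep x)
      ; r-⇔  = λ x y → subst (λ b → (_ × T b) ⇔ _) (sym (same (r≢ x y))) (r-⇔ rep x y)
      }
      where
      same : ∀ {a} → (∀ y → a ≢ t y) → w (var a) ≡ v (var a)
      same a≢ = v≈w _ λ y eq → a≢ y (var-injective eq)

    represents-in° : ∀ {v w} → Represents v → v ≈[ in° ] w → Represents w
    represents-in° = represents-≈ (λ _ _ ()) (λ _ _ _ ())

    represents-in′ : ∀ {v w} → Represents v → v ≈[ in′ ] w → Represents w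
    represents-in′ = represents-≈ (λ _ _ ()) (λ _ _ _ ())

    -- A valuation may set `r` variables outside the framework; the two membership hypotheses ensure
    -- that those consulted here are attacks of `R`.
    ⊨-attacked : ∀ {v} t → Represents v → subsetOf t v ⊆ A → ∀ {x} → x ∈ˢ A →
                 v ⊨ attacked t x ⇔ (_⁺ F (subsetOf t v)) x
    ⊨-attacked {v} t rep E⊆A {x} x∈A =
      mk⇔ (λ (y , y∈E , yrx) → x∈A , y , y∈E , to (r-⇔ rep y x) ((E⊆A y∈E , x∈A) , yrx))
          (λ (_ , y , y∈E , yRx) → y , y∈E , proj₂ (from (r-⇔ rep y x) yRx))
      ⇔-∘ ⊨-⋁ (λ y → (y ∈? subsetOf t v) ×-dec T? (v (var (r y x))))
            (λ y → ∈-subsetOf t v y ×-⇔ ⇔-id _)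

    -- `range` unfolds to `Rg` at `in°` and to `Rg′` at `in′`, so both are covered at once.
    ⊨-range : ∀ {v} t → Represents v → subsetOf t v ⊆ A → ∀ x →
              v ⊨ range t x ⇔ (_⊕ F (subsetOf t v)) x
    ⊨-range {v} t rep E⊆A x =
      ⊨-∨ v (atom (var (t x))) (𝚊𝚠 x ∧ᶠ attacked t x)
        (x ∈? subsetOf t v) (_⁺? F (subsetOf t v) x) (∈-subsetOf t v x)
        (mk⇔ proj₂ (λ x∈E⁺ → proj₁ x∈E⁺ , x∈E⁺) ⇔-∘
         ×-cong-⇔ (aw-⇔ rep x) (⊨-attacked t rep E⊆A))

    ⊨-Defended : ∀ {v} → Represents v → 𝖤 v ⊆ A → ∀ {x} → x ∈ˢ A →
                 v ⊨ Defended x ⇔ Defends F (𝖤 v) x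
    ⊨-Defended {v} rep E⊆A {x} x∈A =
      mk⇔ (λ h y y∈A yRx → h y (y∈A , proj₂ (from (r-⇔ rep y x) yRx)))
          (λ h y (y∈A , yrx) → h y y∈A (to (r-⇔ rep y x) ((y∈A , x∈A) , yrx)))
      ⇔-∘ ⊨-⋀ (λ y → ⊨-⇒ v (𝚊𝚠 y ∧ᶠ 𝚛 y x) (attacked in° y)
            (aw-⇔ rep y ×-⇔ ⇔-id _) (λ (y∈A , _) → ⊨-attacked in° rep E⊆A y∈A))

    infix 4 _encodes_

    -- Since `v` is arbitrary, an encoding applies again at every state a program reaches, where the
    -- framework is the same and the subset may be new.
    _encodes_ : Formula → Pred (Subset n) 0ℓ → Set
    φ encodes P = ∀ {v} → Represents v → v ⊨ φ ⇔ P (𝖤 v)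

    well-encodes : Well encodes (_⊆ A)
    well-encodes {v} rep =
      mk⇔ (λ h {x} → h x) (λ h x → h {x}) ⇔-∘
      ⊨-⋀ (λ x → ⊨-⇒ v (𝚒𝚗 x) (𝚊𝚠 x) (∈-subsetOf in° v x) (λ _ → aw-⇔ rep x))

    conFree-encodes : ConFree encodes ConflictFree F
    conFree-encodes {v} rep = ×-cong-⇔ (well-encodes rep) λ E⊆A →
      mk⇔
        (λ h x (x∈E , x∈A , y , y∈E , yRx) →
          h y x (y∈E , x∈E , proj₂ (from (r-⇔ rep y x) yRx)))
        (λ h x y (x∈E , y∈E , xry) →
          h y (y∈E , E⊆A y∈E , x , x∈E , to (r-⇔ rep x y) ((E⊆A x∈E , E⊆A y∈E) , xry)))
      ⇔-∘ ⊨-⋀ (λ x → ⊨-⋀ λ y → ¬-cong-⇔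
            (∈-subsetOf in° v x ×-⇔ (∈-subsetOf in° v y ×-⇔ ⇔-id _)))

    admissible-encodes : Admissible encodes IsAdmissible F
    admissible-encodes {v} rep = ×-cong-⇔ (conFree-encodes rep) λ (E⊆A , _) →
      ⊨-⋀ λ x → ⊨-⇒ v (𝚒𝚗 x) (Defended x) (∈-subsetOf in° v x)
        (λ x∈E → ⊨-Defended rep E⊆A (E⊆A x∈E))

    complete-encodes : Complete encodes IsComplete F
    complete-encodes {v} rep = ×-cong-⇔ (conFree-encodes rep) λ (E⊆A , _) →
      ⊨-⋀ λ x → ⊨-⇒ v (𝚊𝚠 x) (𝚒𝚗 x ⇔ᶠ Defended x) (aw-⇔ rep x)
        (λ x∈A → ⊨-⇔ᶠ v (𝚒𝚗 x) (Defended x) (∈-subsetOf in° v x) (⊨-Defended rep E⊆A x∈A))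

    stable-encodes : Stable encodes IsStable F
    stable-encodes {v} rep = rearrange ⇔-∘ ×-cong-⇔ (well-encodes rep) λ E⊆A →
      ⊨-⋀ λ x → ⊨-⇒ v (𝚊𝚠 x) (𝚒𝚗 x ⇔ᶠ ¬ᶠ attacked in° x) (aw-⇔ rep x)
        (λ x∈A → ⊨-⇔ᶠ v (𝚒𝚗 x) (¬ᶠ attacked in° x) (∈-subsetOf in° v x)
          (¬-cong-⇔ (⊨-attacked in° rep E⊆A x∈A)))
      where
      E = 𝖤 v

      -- One half of the biconditional is conflict-freeness; the contrapositive of the other says
      -- that `E` attacks all of `A` outside it.
      rearrange : (E ⊆ A × (∀ x → x ∈ˢ A → x ∈ˢ E ⇔ (¬ (_⁺ F E) x))) ⇔ IsStable F E
      rearrange = mk⇔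
        (λ (E⊆A , h) → (E⊆A , λ x (x∈E , x∈E⁺) → to (h x (E⊆A x∈E)) x∈E x∈E⁺) ,
          λ x x∈A x∉E → decidable-stable (_⁺? F E x) (x∉E ∘ from (h x x∈A)))
        (λ ((E⊆A , cf) , h) → E⊆A , λ x x∈A → mk⇔ (λ x∈E x∈E⁺ → cf x (x∈E , x∈E⁺))
          λ x∉E⁺ → decidable-stable (x ∈? E) (x∉E⁺ ∘ h x x∈A))

    -- Boxes as quantifiers over competing subsets.

    -- A competitor `E` is realised by overwriting the `in°` variables of `v`, and `π` reaches that
    -- state when `𝖤 v ≺ E`.
    maximal-encodes : ∀ (_≺_ : Rel (Subset n) 0ℓ) P φ π →
      (∀ v w → ∥ π ∥ v w ⇔ (v ≈[ in° ] w × 𝖤 v ≺ 𝖤 w)) →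
      φ encodes P → φ ∧ᶠ [ π ] ¬ᶠ φ encodes Maximal _≺_ P
    maximal-encodes _≺_ P φ π π-⇔ enc {v} rep = enc rep ×-⇔ mk⇔ maximal unreachable
      where
      maximal : (∀ w → ∥ π ∥ v w → ¬ (w ⊨ φ)) → ∀ E → P E → ¬ (𝖤 v ≺ E)
      maximal h E PE v≺E =
        h w (from (π-⇔ v w) (v≈w , subst (𝖤 v ≺_) (sym w≡E) v≺E))
          (from (enc (represents-in° rep v≈w)) (subst P (sym w≡E) PE))
        where
        w   = overwrite in° E v
        v≈w = ≈-overwrite in° E v
        w≡E = subsetOf-overwrite in° E v in°-injective

      unreachable : (∀ E → P E → ¬ (𝖤 v ≺ E)) → ∀ w → ∥ π ∥ v w → ¬ (w ⊨ φ)
      unreachable h w vπw w⊨φ = let v≈w , v≺w = to (π-⇔ v w) vπw in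
        h (𝖤 w) (to (enc (represents-in° rep v≈w)) w⊨φ) v≺w

    -- Adding arguments one at a time suffices, as conflict-freeness passes to subsets.
    naive-encodes : .{{_ : NonZero n}} → Naive encodes IsNaive F
    naive-encodes {v} rep = conFree-encodes rep ×-⇔ mk⇔ maximal unreachable
      where
      maximal : (∀ w → ∥ mkTrueOne IN ∥ v w → ¬ (w ⊨ ConFree)) →
                ∀ E → ConflictFree F E → ¬ (𝖤 v ⊂ E)
      maximal h E cf (v⊆E , x , x∈E , x∉v) =
        h w (from (one*-⇔ true _ trueOne-⇔ v w) (x , from (∉𝖤-⇔ v x) x∉v , λ _ → refl))
          (from (conFree-encodes (represents-in° rep (≈-assign {v = v} {x = x} λ _ → refl)))
            (conflictFree-⊆ F w⊆E cf))
        where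
        w = v [ var (in° x) ↦ true ]

        w⊆E : 𝖤 w ⊆ E
        w⊆E {y} y∈w = helper (from (∈𝖤-⇔ w y) y∈w)
          where
          helper : w (var (in° y)) ≡ true → y ∈ˢ E
          helper wy with var (in° y) ≟ var (in° x)
          ... | yes eq = subst (_∈ˢ E) (sym (in°-injective (var-injective eq))) x∈E
          ... | no _   = v⊆E (to (∈𝖤-⇔ v y) wy)

      unreachable : (∀ E → ConflictFree F E → ¬ (𝖤 v ⊂ E)) →
                    ∀ w → ∥ mkTrueOne IN ∥ v w → ¬ (w ⊨ ConFree)
      unreachable h w vw w⊨φ =
        let x , vx , w≗ = to (one*-⇔ true _ trueOne-⇔ v w) vw
            v≈w , mono  = shift-assign true w≗
        in h (𝖤 w) (to (conFree-encodes (represents-in° rep v≈w)) w⊨φ)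
             ((λ {y} y∈ → to (∈𝖤-⇔ w y) (mono y (from (∈𝖤-⇔ v y) y∈))) ,
              x , to (∈𝖤-⇔ w x) (trans (w≗ _) (assign-same v _ true)) , to (∉𝖤-⇔ v x) vx)

    vary-such-that-⇔ : ∀ P φ → φ encodes P → ∀ {v} → Represents v → ∀ w →
                       ∥ vary-such-that φ ∥ v w ⇔ (v ≈[ in° ] w × P (𝖤 w))
    vary-such-that-⇔ P φ enc {v} rep w = mk⇔
      (λ (u , vu , u≗w , u⊨φ) → let v≈u = to (vary-⇔ v u) vu in
        (λ p p∉ → trans (sym (u≗w p)) (v≈u p p∉)) ,
        subst P (tabulate-cong λ x → u≗w _) (to (enc (represents-in° rep v≈u)) u⊨φ))
      (λ (v≈w , Pw) → w , from (vary-⇔ v w) v≈w , (λ _ → refl) ,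
        from (enc (represents-in° rep v≈w)) Pw)

    -- The common shape of ideal and eager sets. The box gives membership of each `x` in all
    -- `Q`-sets; exchanging the quantifiers gives inclusion in each.
    sceptical-encodes : ∀ P Q φ ψ → φ encodes P → ψ encodes Q →
      φ ∧ᶠ (⋀ λ x → 𝚒𝚗 x ⇒ᶠ [ vary-such-that ψ ] 𝚒𝚗 x) encodes
      (λ E → P E × (∀ E′ → Q E′ → E ⊆ E′))
    sceptical-encodes P Q φ ψ φ-enc ψ-enc {v} rep = φ-enc rep ×-⇔
      (mk⇔ (λ h E′ QE′ {x} x∈E → h x x∈E E′ QE′) (λ h x x∈E E′ QE′ → h E′ QE′ x∈E) ⇔-∘
       ⊨-⋀ (λ x → ⊨-⇒ v (𝚒𝚗 x) ([ vary-such-that ψ ] 𝚒𝚗 x) (∈-subsetOf in° v x)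
         λ _ → necessarily x))
      where
      necessarily : ∀ x → v ⊨ ([ vary-such-that ψ ] 𝚒𝚗 x) ⇔ (∀ E → Q E → x ∈ˢ E)
      necessarily x = mk⇔
        (λ h E QE →
          let w   = overwrite in° E v
              w≡E = subsetOf-overwrite in° E v in°-injective
          in subst (x ∈ˢ_) w≡E (to (∈-subsetOf in° w x)
               (h w (from (vary-such-that-⇔ Q ψ ψ-enc rep w)
                 (≈-overwrite in° E v , subst Q (sym w≡E) QE)))))
        (λ h w vw → from (∈-subsetOf in° w x)
          (h (𝖤 w) (proj₂ (to (vary-such-that-⇔ Q ψ ψ-enc rep w) vw))))

    -- The `in′` variables remember the old set while `in°` holds a competitor. That inclusion of
    -- the old range in the new one implies the converse inclusion is exactly the denial of a
    -- strictly larger range.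
    rangeMaximal-encodes : ∀ P φ → φ encodes P → (∀ {E} → P E → E ⊆ A) →
      φ ∧ᶠ [ copy ⨾ vary-such-that φ ] (IncludesCp ⇒ᶠ IncludedInCp) encodes
      Maximal (_⊂⊕_ F) P
    rangeMaximal-encodes P φ enc P⊆A {v} rep =
      ×-cong-⇔ (enc rep) λ Pv → mk⇔ (maximal Pv) (unreachable Pv)
      where
      comparison-⇔ : ∀ {w} → Represents w → subsetOf in′ w ⊆ A → 𝖤 w ⊆ A →
        w ⊨ (IncludesCp ⇒ᶠ IncludedInCp) ⇔
        ((∀ x → (_⊕ F (subsetOf in′ w)) x → (_⊕ F (𝖤 w)) x) →
         (∀ x → (_⊕ F (𝖤 w)) x → (_⊕ F (subsetOf in′ w)) x))
      comparison-⇔ {w} rep′ old⊆A new⊆A = ⊨-⇒ w IncludesCp IncludedInCp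
        (⊨-⋀ λ x → ⊨-⇒ w (Rg′ x) (Rg x) (old x) λ _ → new x)
        (λ _ → ⊨-⋀ λ x → ⊨-⇒ w (Rg x) (Rg′ x) (new x) λ _ → old x)
        where
        old = ⊨-range in′ rep′ old⊆A
        new = ⊨-range in° rep′ new⊆A

      maximal : P (𝖤 v) →
        (∀ w → ∥ copy ⨾ vary-such-that φ ∥ v w → w ⊨ (IncludesCp ⇒ᶠ IncludedInCp)) →
        ∀ E → P E → ¬ (_⊂⊕_ F (𝖤 v) E)
      maximal Pv h E PE (v⊆E , E⊈v) = E⊈v λ {x} x∈ → subst (λ D → (_⊕ F D) x) w′≡v
        (to (comparison-⇔ (represents-in° rep-u u≈w)
              (subst (_⊆ A) (sym w′≡v) (P⊆A Pv)) (P⊆A Pw))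
          (h w (u , from (copy-⇔ v u) (v≈u , copied) ,
                from (vary-such-that-⇔ P φ enc rep-u w) (u≈w , Pw)))
          (λ y y∈ → subst (λ D → (_⊕ F D) y) (sym w≡E)
            (v⊆E (subst (λ D → (_⊕ F D) y) w′≡v y∈)))
          x (subst (λ D → (_⊕ F D) x) (sym w≡E) x∈))
        where
        -- The run to be exhibited: `copy` leads from `v` to `u`, then `vary` from `u` to `w`.
        u     = overwrite in′ (𝖤 v) v
        v≈u   = ≈-overwrite in′ (𝖤 v) v
        rep-u = represents-in′ rep v≈u
        w     = overwrite in° E u
        u≈w   = ≈-overwrite in° E u
        w≡E   = subsetOf-overwrite in° E u in°-injective
        w′≡v : subsetOf in′ w ≡ 𝖤 v
        w′≡v  = trans (subsetOf-≈ u≈w λ _ _ ()) (subsetOf-overwrite in′ (𝖤 v) v in′-injective)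
        Pw    = subst P (sym w≡E) PE
        copied : ∀ x → u (var (in′ x)) ≡ v (var (in° x))
        copied x = trans (overwrite-lookup in′ (𝖤 v) v in′-injective x) (lookup∘tabulate _ x)

      unreachable : P (𝖤 v) → (∀ E → P E → ¬ (_⊂⊕_ F (𝖤 v) E)) →
        ∀ w → ∥ copy ⨾ vary-such-that φ ∥ v w → w ⊨ (IncludesCp ⇒ᶠ IncludedInCp)
      unreachable Pv h w (u , vu , uw) =
        from (comparison-⇔ (represents-in° (represents-in′ rep v≈u) u≈w)
               (subst (_⊆ A) (sym w′≡v) (P⊆A Pv)) (P⊆A Pw))
          -- A point of the new range outside the old one would make the inclusion strict;
          -- decidability of ranges turns this refutation into membership.
          λ old⊆new x x∈ → decidable-stable (_⊕? F (subsetOf in′ w) x) λ x∉ →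
            h (𝖤 w) Pw
              ((λ {y} y∈ → old⊆new y (subst (λ D → (_⊕ F D) y) (sym w′≡v) y∈)) ,
               λ new⊆v → x∉ (subst (λ D → (_⊕ F D) x) (sym w′≡v) (new⊆v x∈)))
        where
        v≈u    = proj₁ (to (copy-⇔ v u) vu)
        copied = proj₂ (to (copy-⇔ v u) vu)
        new    = to (vary-such-that-⇔ P φ enc (represents-in′ rep v≈u) w) uw
        u≈w    = proj₁ new
        Pw     = proj₂ new
        w′≡v : subsetOf in′ w ≡ 𝖤 v
        w′≡v = trans (subsetOf-≈ u≈w λ _ _ ()) (tabulate-cong copied)

    -- The encodings of all nine semantics.

    module _ .{{_ : NonZero n}} where

      ⊂-maximal-encodes : ∀ P φ → φ encodes P →
        φ ∧ᶠ [ mkTrueOne IN ⨾ mkTrueSome IN ] ¬ᶠ φ encodes Maximal _⊂_ P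
      ⊂-maximal-encodes P φ = maximal-encodes _⊂_ P φ (mkTrueOne IN ⨾ mkTrueSome IN) enlarge-⇔

      preferred-encodes : Preferred encodes IsPreferred F
      preferred-encodes rep = maximalAdmissible⇔preferred F ⇔-∘
        ⊂-maximal-encodes (IsAdmissible F) Admissible admissible-encodes rep

      semiStable-encodes : SemiStable encodes IsSemiStable F
      semiStable-encodes =
        rangeMaximal-encodes (IsComplete F) Complete complete-encodes (proj₁ ∘ proj₁)

      encoding-encodes : ∀ σ → encoding σ encodes Extensions σ F
      encoding-encodes st  = stable-encodes
      encoding-encodes co  = complete-encodes
      encoding-encodes gr  = maximal-encodes _⊃_ (IsComplete F)
        Complete (mkFalseOne IN ⨾ mkFalseSome IN) shrink-⇔ complete-encodes
      encoding-encodes pr  = preferred-encodes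
      encoding-encodes se  = semiStable-encodes
      encoding-encodes id  = ⊂-maximal-encodes (IsIdealSet F) IdealSet
        (sceptical-encodes (IsAdmissible F) (IsPreferred F) Admissible Preferred
          admissible-encodes preferred-encodes)
      encoding-encodes ea  = ⊂-maximal-encodes (IsEagerSet F) EagerSet
        (sceptical-encodes (IsAdmissible F) (IsSemiStable F) Admissible SemiStable
          admissible-encodes semiStable-encodes)
      encoding-encodes na  = naive-encodes
      encoding-encodes stg = rangeMaximal-encodes (ConflictFree F)
        ConFree conFree-encodes proj₁

  -- Represented frameworks and the two claims.

  frame-represents : ∀ v → Represents (frame v) v
  frame-represents v = record
    { aw-⇔ = ∈-subsetOf aw v
    ; r-⇔  = λ x y → mk⇔ (fromWitness {a? = R? v x y}) (toWitness {a? = R? v x y})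
    }

  -- Injectivity of `var` keeps `aw` and `r` variables apart, so each is true only through its own
  -- disjunct of `valuation`; `R⊆A×A` supplies the memberships.
  valuation-represents : ∀ F → Represents F (valuation F)
  valuation-represents F = record { aw-⇔ = aw-⇔ ; r-⇔ = r-⇔ }
    where
    open AF F

    IsAw IsR : Pred Prp 0ℓ
    IsAw p = ∃[ x ] (p ≡ var (aw x) × x ∈ˢ A)
    IsR p  = ∃[ x ] ∃[ y ] (p ≡ var (r x y) × T (R x y))

    -- Repeats the test inside `valuation`, so that `toWitness` and `fromWitness` apply to its
    -- Boolean; likewise `r?`.
    aw? : Decidable IsAw
    aw? p = any? λ x → (p ≟ var (aw x)) ×-dec (x ∈? A)

    r? : Decidable IsR
    r? p = any? λ x → any? λ y → (p ≟ var (r x y)) ×-dec T? (R x y)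

    valuation⁻ : ∀ p → T (valuation F p) → IsAw p ⊎ IsR p
    valuation⁻ p h =
      [ inj₁ ∘ toWitness {a? = aw? p} , inj₂ ∘ toWitness {a? = r? p} ]′ (to T-∨ h)

    aw-⇔ : ∀ x → T (valuation F (var (aw x))) ⇔ x ∈ˢ A
    aw-⇔ x = mk⇔ (λ h → only (valuation⁻ _ h))
      (λ x∈A → from T-∨ (inj₁ (fromWitness {a? = aw? _} (x , refl , x∈A))))
      where
      only : IsAw (var (aw x)) ⊎ IsR (var (aw x)) → x ∈ˢ A
      only (inj₁ (y , eq , y∈A)) with refl ← var-injective eq = y∈A
      only (inj₂ (_ , _ , eq , _)) = contradiction (var-injective eq) λ ()

    r-⇔ : ∀ x y → ((x ∈ˢ A × y ∈ˢ A) × T (valuation F (var (r x y)))) ⇔ T (R x y)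
    r-⇔ x y = mk⇔ (λ (_ , h) → only (valuation⁻ _ h))
      (λ xRy → R⊆A×A xRy , from T-∨ (inj₂ (fromWitness {a? = r? _} (x , y , refl , xRy))))
      where
      only : IsAw (var (r x y)) ⊎ IsR (var (r x y)) → T (R x y)
      only (inj₁ (_ , eq , _)) = contradiction (var-injective eq) λ ()
      only (inj₂ (_ , _ , eq , xRy)) with refl ← var-injective eq = xRy

theorem1 : (n : ℕ) .{{_ : NonZero n}} (L : Vocabulary n) → let open DL-PA L in
    (σ : Semantics) (v : Valuation) (F : AF n) →
    (v ⊨ encoding σ ⇔ 𝖤 v ∈ Extensions σ (frame v)) ×
    (Extensions σ F ≐ (λ E → ∃[ w ] (∥ makeExt σ ∥ (valuation F) w × E ≡ 𝖤 w)))
theorem1 n L σ v F =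
  encoding-encodes L (frame v) σ (frame-represents L v) ,
  (λ {E} ext →
    let w   = overwrite L in° E (valuation F)
        w≡E = subsetOf-overwrite L in° E (valuation F) in°-injective
    in w , from (makeExt-⇔ w) (≈-overwrite L in° E (valuation F) ,
                               subst (Extensions σ F) (sym w≡E) ext) , sym w≡E) ,
  (λ { (w , run , refl) → proj₂ (to (makeExt-⇔ w) run) })
  where
  open DL-PA L
  makeExt-⇔ = vary-such-that-⇔ L F (Extensions σ F) (encoding σ) (encoding-encodes L F σ)
                (valuation-represents L F)
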